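{- For every $\epsilon > 0$ there is a constant $c$ such that every parenthesis matching $M$ on $n$ vertices satisfies $$r_<(M, K_3) \leq c\, n^{1+\epsilon}.$$
   Context: An ordered graph on $n$ vertices is a graph whose vertex set is $\{1,\dots,n\}$ with its natural order. An ordered matching is an ordered graph in which every vertex has degree exactly $1$. A copy of an ordered graph $G$ on $\{1,\dots,m\}$ inside an edge-colored ordered complete graph on $\{1,\dots,N\}$ is an increasing map $\phi:\{1,\dots,m\}\to\{1,\dots,N\}$ such that $\phi(u)\phi(v)$ is an edge for every edge $uv$ of $G$; it is red (resp. blue) if all these image edges are red (resp. blue). For ordered graphs $G,H$, the ordered Ramsey number $r_<(G,H)$ is the smallest nonnegative integer $N$ such that every red/blue coloring of the edges of the ordered complete graph on $\{1,\dots,N\}$ contains a red copy of $G$ or a blue copy of $H$. $K_3$ denotes the triangle. A parenthesis matching is an ordered matching in which no two edges cross: for any two edges $\{i,j\}$ and $\{k,l\}$ with $i<j$, $k<l$, the intervals $[i,j]$ and $[k,l]$ are either disjoint or one is contained in the other. -}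

module Defs where

open import Data.Nat using (ℕ)
open import Data.Fin using (Fin; _<_; _≤_)
open import Data.Product using (Σ; ∃; _×_; _,_)
open import Data.Sum using (_⊎_)
open import Relation.Binary.PropositionalEquality using (_≡_; _≢_)
open import Relation.Nullary using (¬_)
open import Level using (0ℓ) renaming (suc to lsuc)

-- An ordered graph on vertex set {1,..,m}, represented by Fin m with its
-- natural order; the edge relation is symmetric and irreflexive.
record OrderedGraph (m : ℕ) : Set₁ where
  field
    Edge  : Fin m → Fin m → Set
    sym   : ∀ {u v} → Edge u v → Edge v u
    irrefl : ∀ {u} → ¬ Edge u u
open OrderedGraph public

IsMatching : ∀ {m} → OrderedGraph m → Set
IsMatching G = ∀ u → Σ _ λ v → Edge G u v × (∀ w → Edge G u w → w ≡ v)

IsNonCrossing : ∀ {m} → OrderedGraph m → Set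
IsNonCrossing G =
  ∀ i j k l → i < j → k < l → Edge G i j → Edge G k l →
    ((j < k) ⊎ (l < i)) ⊎ ((k ≤ i × j ≤ l) ⊎ (i ≤ k × l ≤ j))

IsParenthesisMatching : ∀ {m} → OrderedGraph m → Set
IsParenthesisMatching G = IsMatching G × IsNonCrossing G

K₃ : OrderedGraph 3
K₃ = record { Edge = λ u v → u ≢ v
            ; sym = λ p q → p (Relation.Binary.PropositionalEquality.sym q)
            ; irrefl = λ p → p Relation.Binary.PropositionalEquality.refl }

data Colour : Set where
  red blue : Colour

-- A red/blue edge colouring of the ordered complete graph on {1,..,N};
-- only the values col u v with u < v are relevant.
Colouring : ℕ → Set
Colouring N = Fin N → Fin N → Colour

HasCopy : ∀ {m N} → Colouring N → Colour → OrderedGraph m → Set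
HasCopy {m} {N} col c G =
  Σ (Fin m → Fin N) λ φ →
    (∀ u v → u < v → φ u < φ v) ×
    (∀ u v → u < v → Edge G u v → col (φ u) (φ v) ≡ c)

Arrows : ∀ {m k} → ℕ → OrderedGraph m → OrderedGraph k → Set
Arrows N G H = (col : Colouring N) → HasCopy col red G ⊎ HasCopy col blue H

{-# OPTIONS --safe #-}

-- Read M as a forest of parentheses and suppose that there is no blue triangle. If a
-- vertex has at least n blue neighbours after it, these form a red clique, which
-- contains M. Otherwise consider a chain of nested edges (a spine) with small forests
-- hanging off it. Process the spine from the outside inwards, spending the same length
-- on the left and on the right at every item, and skip one position on both sides
-- whenever the next edge is blue. The process stays on one diagonal of the left × right
-- grid, so it wastes at most one position per blue entry there; averaging over O(n)
-- diagonals gives one that is at most half blue. A spine whose hanging forests need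
-- total length W therefore costs 4W + O(n).
-- Cutting the forest at subtrees with n/T edges leaves O(T) spines, so the length per
-- edge satisfies λ(n) ≤ 4 λ(n/T) + O(T) ≤ 5 λ(n/T) once λ = Ω(T). Hence
-- λ(n) = O(n^(log 5 / log T)), and T is taken large.
module Submission where

open import Defs hiding (sym)
open import Data.Nat using (ℕ; _^_; _*_; _+_; _<_; _≤_)
open import Data.Nat using (zero; suc; z≤n; s≤s; _∸_; _≤?_; _<?_; >-nonZero)
open import Data.Nat.Properties
open import Data.Nat.Tactic.RingSolver using (solve-∀)
open import Data.Fin using (Fin; toℕ; fromℕ<)
import Data.Fin as Fin
import Data.Fin.Properties as Fin
open import Data.Product using (Σ; _×_; _,_; proj₁; proj₂; ∃; ∃₂)
open import Data.Sum using (_⊎_; inj₁; inj₂)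
open import Data.Empty using (⊥-elim)
open import Relation.Nullary using (¬_; Dec; yes; no; contradiction; _×-dec_)
open import Relation.Binary.Definitions using (tri<; tri≈; tri>)
open import Relation.Binary.PropositionalEquality
  using (_≡_; _≢_; refl; sym; trans; cong; cong₂; subst; subst₂)

-- Finite sums and averaging

sum< : (ℕ → ℕ) → ℕ → ℕ
sum< f zero    = 0
sum< f (suc n) = f n + sum< f n

sum<-cong : ∀ {f g} → (∀ i → f i ≡ g i) → ∀ n → sum< f n ≡ sum< g n
sum<-cong eq zero    = refl
sum<-cong eq (suc n) = cong₂ _+_ (eq n) (sum<-cong eq n)

sum<-zero : ∀ n → sum< (λ _ → 0) n ≡ 0
sum<-zero zero    = refl
sum<-zero (suc n) = sum<-zero n

sum<-distrib-+ : ∀ f g n → sum< (λ i → f i + g i) n ≡ sum< f n + sum< g n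
sum<-distrib-+ f g zero    = refl
sum<-distrib-+ f g (suc n) =
  trans (cong (f n + g n +_) (sum<-distrib-+ f g n)) (interchange (f n) (g n) _ _)
  where
  interchange : ∀ a b c d → a + b + (c + d) ≡ a + c + (b + d)
  interchange = solve-∀

sum<-swap : ∀ (h : ℕ → ℕ → ℕ) m n →
  sum< (λ j → sum< (λ i → h i j) m) n ≡ sum< (λ i → sum< (h i) n) m
sum<-swap h zero    n = sum<-zero n
sum<-swap h (suc m) n =
  trans (sum<-distrib-+ (h m) (λ j → sum< (λ i → h i j) m) n)
        (cong (sum< (h m) n +_) (sum<-swap h m n))

sum<-split : ∀ f m n → sum< f (m + n) ≡ sum< (λ i → f (m + i)) n + sum< f m
sum<-split f m zero    = cong (sum< f) (+-identityʳ m)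
sum<-split f m (suc n) = trans (cong (sum< f) (+-suc m n))
  (trans (cong (f (m + n) +_) (sum<-split f m n)) (sym (+-assoc (f (m + n)) _ _)))

sum<-mono-length : ∀ f {m n} → m ≤ n → sum< f m ≤ sum< f n
sum<-mono-length f {m} m≤n with m≤n⇒∃[o]m+o≡n m≤n
... | o , refl = ≤-trans (m≤n+m _ _) (≤-reflexive (sym (sum<-split f m o)))

sum<-bounded : ∀ f b n → (∀ i → i < n → f i ≤ b) → sum< f n ≤ n * b
sum<-bounded f b zero    f≤b = z≤n
sum<-bounded f b (suc n) f≤b =
  +-mono-≤ (f≤b n ≤-refl) (sum<-bounded f b n (λ i i<n → f≤b i (m<n⇒m<1+n i<n)))

sum<-pigeonhole : ∀ f b n → 0 < n → sum< f n ≤ n * b → ∃ λ i → i < n × f i ≤ b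
sum<-pigeonhole f b (suc n) _ le with f n ≤? b
... | yes fn≤b = n , ≤-refl , fn≤b
sum<-pigeonhole f b (suc zero)    _ le | no fn≰b =
  ⊥-elim (fn≰b (subst₂ _≤_ (+-identityʳ _) (+-identityʳ _) le))
sum<-pigeonhole f b (suc (suc n)) _ le | no fn≰b
  with sum<-pigeonhole f b (suc n) (s≤s z≤n)
         (+-cancelˡ-≤ b _ _ (≤-trans (+-monoˡ-≤ _ (<⇒≤ (≰⇒> fn≰b))) le))
... | i , i<n , fi≤b = i , m<n⇒m<1+n i<n , fi≤b

-- Each of the `l` top terms given up is at most 1. In the layout they are the diagonal entries used
-- up by a hanging forest.
drop-sum : ∀ {f} → (∀ i → f i ≤ 1) → ∀ l {w} k → l + w ≤ sum< f k →
  ∃ λ k′ → k ≡ k′ + l × w ≤ sum< f k′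
drop-sum f≤1 zero    k       le = k , sym (+-identityʳ k) , le
drop-sum {f} f≤1 (suc l) (suc k) le
  with drop-sum f≤1 l k (+-cancelˡ-≤ 1 _ _ (≤-trans le (+-monoˡ-≤ (sum< f k) (f≤1 k))))
... | k′ , refl , le′ = k′ , sym (+-suc k′ l) , le′

-- The scan starts at the top, so the `g` terms skipped above `k′` are 0 and only one unit of the
-- sum is lost. The skipped terms will be blue diagonal entries.
find-one : ∀ {f} → (∀ i → f i ≤ 1) → ∀ {w} k → suc w ≤ sum< f k →
  ∃₂ λ k′ g → k ≡ suc k′ + g × f k′ ≡ 1 × w ≤ sum< f k′
find-one {f} f≤1 (suc k) le with f k in eq | f≤1 k
... | zero        | _ with find-one f≤1 k le
...   | k′ , g , refl , one , le′ = k′ , suc g , cong suc (sym (+-suc k′ g)) , one , le′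
find-one {f} f≤1 (suc k) le | suc zero | _ =
  k , 0 , cong suc (sym (+-identityʳ k)) , eq , ≤-pred le
find-one {f} f≤1 (suc k) le | suc (suc _) | s≤s ()

-- Ordered forests and colour counts

infixr 5 ⟨_⟩_

data Forest : Set where
  ∙    : Forest
  ⟨_⟩_ : Forest → Forest → Forest

size : Forest → ℕ
size ∙         = 0
size (⟨ A ⟩ B) = suc (size A + size B)

isBlue isRed : Colour → ℕ
isBlue red  = 0
isBlue blue = 1
isRed red  = 1
isRed blue = 0

isRed≤1 : ∀ k → isRed k ≤ 1
isRed≤1 red  = ≤-refl
isRed≤1 blue = z≤n

isRed⁻¹ : ∀ k → isRed k ≡ 1 → k ≡ red
isRed⁻¹ red _ = refl

red+blue : ∀ (f : ℕ → Colour) n → sum< (λ i → isRed (f i)) n + sum< (λ i → isBlue (f i)) n ≡ n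
red+blue f zero = refl
red+blue f (suc n) with f n
... | red  = cong suc (red+blue f n)
... | blue = trans (+-suc _ _) (cong suc (red+blue f n))

-- Red embeddings of forests

module Embedding
  (c : ℕ → ℕ → Colour)
  (triangle-free : ∀ x y z → x < y → y < z → c x y ≡ blue → c x z ≡ blue → c y z ≡ red)
  where

  -- Intervals are half-open: positions run from `lo` up to but excluding `hi`, and `x`, `y` are the
  -- ends of the first edge.
  data Emb : Forest → ℕ → ℕ → Set where
    nil  : ∀ {lo hi} → lo ≤ hi → Emb ∙ lo hi
    node : ∀ {A B lo hi x y} → lo ≤ x → c x y ≡ red →
           Emb A (suc x) y → Emb B (suc y) hi → Emb (⟨ A ⟩ B) lo hi

  widen : ∀ {P lo lo′ hi hi′} → lo′ ≤ lo → hi ≤ hi′ → Emb P lo hi → Emb P lo′ hi′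
  widen p q (nil le)        = nil (≤-trans p (≤-trans le q))
  widen p q (node le r a b) = node (≤-trans p le) r a (widen ≤-refl q b)

  Emb⇒≤ : ∀ {P lo hi} → Emb P lo hi → lo ≤ hi
  Emb⇒≤ (nil le)        = le
  Emb⇒≤ (node le _ a b) =
    ≤-trans le (≤-trans (n≤1+n _) (≤-trans (Emb⇒≤ a) (≤-trans (n≤1+n _) (Emb⇒≤ b))))

  append : ∀ {A B lo mid hi} → Emb (⟨ A ⟩ ∙) lo mid → Emb B mid hi → Emb (⟨ A ⟩ B) lo hi
  append (node le r a (nil q)) b = node le r a (widen q ≤-refl b)

  deg : ℕ → ℕ → ℕ → ℕ
  deg x y n = sum< (λ i → isBlue (c x (y + i))) n

  deg-mono : ∀ x {y y′ n n′} → y ≤ y′ → y′ + n′ ≤ y + n → deg x y′ n′ ≤ deg x y n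
  deg-mono x {y} {n = n} {n′} y≤y′ le with m≤n⇒∃[o]m+o≡n y≤y′
  ... | g , refl = begin
    deg x (y + g) n′
      ≡⟨ sum<-cong (λ i → cong (λ t → isBlue (c x t)) (+-assoc y g i)) n′ ⟩
    sum< (λ i → isBlue (c x (y + (g + i)))) n′
      ≤⟨ m≤m+n _ _ ⟩
    sum< (λ i → isBlue (c x (y + (g + i)))) n′ + deg x y g
      ≡⟨ sum<-split (λ i → isBlue (c x (y + i))) g n′ ⟨
    deg x y (g + n′)
      ≤⟨ sum<-mono-length _ (+-cancelˡ-≤ y _ _ (subst (_≤ y + n) (+-assoc y g n′) le)) ⟩
    deg x y n ∎
    where open ≤-Reasoning

  -- Blue neighbours are counted from the right: the first `r` go to the suffix, the next one is the
  -- answer, and at least `k` remain before it.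
  nth-blue : ∀ x k r y n → k + suc r ≤ deg x y n →
    ∃₂ λ i j → n ≡ suc i + j × c x (y + i) ≡ blue × k ≤ deg x y i × r ≤ deg x (suc (y + i)) j
  nth-blue x k r y zero    le with () ← subst (_≤ 0) (+-suc k r) le
  nth-blue x k r y (suc n) le with c x (y + n) in eq
  nth-blue x k r y (suc n) le | red with nth-blue x k r y n le
  ... | i , j , refl , b , kk , rr =
    i , suc j , cong suc (sym (+-suc i j)) , b , kk , ≤-trans rr (m≤n+m _ _)
  nth-blue x k zero y (suc n) le | blue =
    n , 0 , cong suc (sym (+-identityʳ n)) , eq ,
    ≤-pred (subst (_≤ suc (deg x y n)) (+-comm k 1) le) , z≤n
  nth-blue x k (suc r) y (suc n) le | blue
    with nth-blue x k r y n (≤-pred (subst (_≤ suc (deg x y n)) (+-suc k (suc r)) le))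
  ... | i , j , refl , b , kk , rr =
    i , suc j , cong suc (sym (+-suc i j)) , b , kk ,
    subst (λ t → suc r ≤ isBlue t + deg x (suc (y + i)) j) (sym eq′) (s≤s rr)
    where
    eq′ : c x (suc (y + i) + j) ≡ blue
    eq′ = trans (cong (c x) (lemma y i j)) eq
      where
      lemma : ∀ y i j → suc (y + i) + j ≡ y + (suc i + j)
      lemma = solve-∀

  -- The forward blue neighbourhood of a vertex is a red clique.
  embed-in-blue-neighbourhood : ∀ x P y n → x < y → 2 * size P ≤ deg x y n → Emb P y (y + n)
  embed-in-blue-neighbourhood x ∙ y n x<y le = nil (m≤m+n y n)
  embed-in-blue-neighbourhood x (⟨ A ⟩ B) y n x<y le
    with nth-blue x 0 (2 * size A + suc (2 * size B)) y n
           (≤-trans (≤-reflexive (lemma (size A) (size B))) le)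
    where
    lemma : ∀ a b → suc (2 * a + suc (2 * b)) ≡ 2 * suc (a + b)
    lemma = solve-∀
  ... | i , j , refl , b₁ , _ , le₁
    with nth-blue x (2 * size A) (2 * size B) (suc (y + i)) j le₁
  ... | i′ , j′ , refl , b₂ , leA , leB =
    node (m≤m+n y i)
         (triangle-free x (y + i) (suc (y + i) + i′) (≤-trans x<y (m≤m+n y i))
            (s≤s (m≤m+n (y + i) i′)) b₁ b₂)
         (embed-in-blue-neighbourhood x A (suc (y + i)) i′ x<1+y+i leA)
         (subst (Emb B (suc (suc (y + i) + i′))) (lemma y i i′ j′)
           (embed-in-blue-neighbourhood x B (suc (suc (y + i) + i′)) j′
              (≤-trans x<1+y+i (≤-trans (m≤m+n _ i′) (n≤1+n _))) leB))
    where
    x<1+y+i : x < suc (y + i)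
    x<1+y+i = ≤-trans x<y (≤-trans (m≤m+n y i) (n≤1+n _))
    lemma : ∀ y i i′ j′ → suc (suc (y + i) + i′) + j′ ≡ y + (suc i + (suc i′ + j′))
    lemma = solve-∀

  -- Spines laid out along a diagonal

  FitsIn : Forest → ℕ → Set
  FitsIn P w = ∀ lo hi → lo + w ≤ hi → Emb P lo hi

  -- P = L₁⟨ L₂⟨ … Q … ⟩R₂ ⟩R₁, where the third index is the number of red diagonal
  -- entries that suffices to lay out everything outside the core Q.
  data Spine (Q : Forest) : Forest → ℕ → Set where
    core : Spine Q Q 0
    left : ∀ {A B l W} → FitsIn (⟨ A ⟩ ∙) l → Spine Q B W → Spine Q (⟨ A ⟩ B) (l + W)
    wrap : ∀ {A B r W} → FitsIn B r → Spine Q A W → Spine Q (⟨ A ⟩ B) (suc r + W)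

  -- The core occupies the positions from `cl` up to `ch`. Index `i` counts outwards from it on both
  -- sides at once, and `e` selects the diagonal by shifting the right side.
  diagonal : ℕ → ℕ → ℕ → ℕ → Colour
  diagonal cl ch e i = c (cl ∸ suc i) (ch + i + e)

  -- Induction along the spine from the outside inwards. Free space runs from `x` to `ch + k + e`;
  -- the `k` diagonal entries still ahead always contain enough red ones for the rest of the spine.
  lay-out : ∀ {Q P W cl ch} e → Emb Q cl ch → Spine Q P W → ∀ k x → x + k ≡ cl →
    W ≤ sum< (λ i → isRed (diagonal cl ch e i)) k → Emb P x (ch + k + e)
  lay-out {ch = ch} e emb core k x refl le =
    widen (m≤m+n x k) (≤-trans (m≤m+n ch k) (m≤m+n (ch + k) e)) emb
  lay-out {cl = cl} {ch} e emb (left {l = l} fits sp) k x refl le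
    with drop-sum (λ i → isRed≤1 (diagonal cl ch e i)) l k le
  ... | k′ , refl , le′ =
    -- The hanging forest takes `l` positions on the left; `l` positions on the right are given up
    -- to stay on the diagonal.
    append (fits x (x + l) ≤-refl)
      (widen ≤-refl (+-monoˡ-≤ e (+-monoʳ-≤ ch (m≤m+n k′ l)))
        (lay-out e emb sp k′ (x + l) (lemma x l k′) le′))
    where
    lemma : ∀ x l k → x + l + k ≡ x + (k + l)
    lemma = solve-∀
  lay-out {cl = cl} {ch} e emb (wrap {r = r} {W} fits sp) k x refl le
    with drop-sum (λ i → isRed≤1 (diagonal cl ch e i)) r k
           (subst (_≤ sum< (λ i → isRed (diagonal cl ch e i)) k) (sym (+-suc r W)) le)
  -- After the `r` positions reserved for `B`, the outermost remaining red entry carries the edge.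
  ... | k₁ , refl , le₁ with find-one (λ i → isRed≤1 (diagonal cl ch e i)) k₁ le₁
  ... | k′ , g , refl , one , le₂ =
    node {x = x′} {y = ch + k′ + e} (≤-trans (m≤m+n x r) (m≤m+n (x + r) g))
      (trans (cong (λ t → c t (ch + k′ + e)) (sym cl-eq)) (isRed⁻¹ _ one))
      (lay-out e emb sp k′ (suc x′) (trans (sym (+-suc x′ k′)) x′-eq) le₂)
      (fits _ _ (≤-trans (m≤m+n _ g) (≤-reflexive (lemma ch k′ e r g))))
    where
    x′ = x + r + g
    lemma₁ : ∀ x r g k → x + r + g + suc k ≡ x + (suc k + g + r)
    lemma₁ = solve-∀
    x′-eq : x′ + suc k′ ≡ cl
    x′-eq = lemma₁ x r g k′
    cl-eq : cl ∸ suc k′ ≡ x′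
    cl-eq = trans (cong (_∸ suc k′) (sym x′-eq)) (m+n∸n≡m x′ (suc k′))
    lemma : ∀ ch k e r g → suc (ch + k + e) + r + g ≡ ch + (suc k + g + r) + e
    lemma = solve-∀

  DegreesBounded : ℕ → ℕ → ℕ → Set
  DegreesBounded Lo Hi d = ∀ x y n → Lo ≤ x → x < y → y + n ≤ Hi → deg x y n ≤ d

  -- Averaging over `d + d` diagonals: each of the `W + W` rows has at most `d` blue entries, so
  -- some diagonal has at most `W` blue entries, which leaves the `W` red ones that `lay-out` asks
  -- for.
  embed-spine : ∀ {Q P W d lo ch} → 0 < d → Spine Q P W → Emb Q (lo + (W + W)) ch →
    DegreesBounded lo (ch + (W + W) + (d + d)) d → Emb P lo (ch + (W + W) + (d + d))
  embed-spine {Q} {P} {W} {d} {lo} {ch} 0<d sp emb bounded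
    with sum<-pigeonhole (λ e → sum< (λ i → isBlue (diagonal cl ch e i)) m) W (d + d)
           (≤-trans 0<d (m≤m+n d d)) blue-total
    where
    m = W + W
    cl = lo + m
    lo≤ : ∀ i → i < m → lo ≤ cl ∸ suc i
    lo≤ i i<m = subst (lo ≤_) (sym (+-∸-assoc lo i<m)) (m≤m+n lo _)
    row : ∀ i → i < m → sum< (λ e → isBlue (diagonal cl ch e i)) (d + d) ≤ d
    -- A row pairs one vertex left of the core with consecutive vertices right of it, so its blue
    -- entries count a forward degree.
    row i i<m = bounded (cl ∸ suc i) (ch + i) (d + d) (lo≤ i i<m)
      (≤-trans (∸-monoʳ-< {cl} (s≤s z≤n) (≤-trans i<m (m≤n+m m lo)))
               (≤-trans (Emb⇒≤ emb) (m≤m+n ch i)))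
      (+-monoˡ-≤ (d + d) (+-monoʳ-≤ ch (<⇒≤ i<m)))
    lemma : ∀ w d → (w + w) * d ≡ (d + d) * w
    lemma = solve-∀
    blue-total : sum< (λ e → sum< (λ i → isBlue (diagonal cl ch e i)) m) (d + d) ≤ (d + d) * W
    blue-total = begin
      sum< (λ e → sum< (λ i → isBlue (diagonal cl ch e i)) m) (d + d)
        ≡⟨ sum<-swap (λ i e → isBlue (diagonal cl ch e i)) m (d + d) ⟩
      sum< (λ i → sum< (λ e → isBlue (diagonal cl ch e i)) (d + d)) m
        ≤⟨ sum<-bounded _ d m row ⟩
      m * d
        ≡⟨ lemma W d ⟩
      (d + d) * W ∎
      where open ≤-Reasoning
  ... | e , e<D , few-blue =
    widen ≤-refl (+-monoʳ-≤ (ch + (W + W)) (<⇒≤ e<D))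
      (lay-out e emb sp (W + W) lo refl enough-red)
    where
    colour = diagonal (lo + (W + W)) ch e
    enough-red : W ≤ sum< (λ i → isRed (colour i)) (W + W)
    enough-red = +-cancelʳ-≤ W _ _
      (≤-trans (≤-reflexive (sym (red+blue colour (W + W)))) (+-monoʳ-≤ _ few-blue))

  -- Cutting a large forest into spines

  -- One recursion step: forests of size at most s cost λ per edge; larger ones then
  -- cost 4λ + μ per edge, with a credit of 2d that pays for the next spine.
  module Step
    (s lam μ d Lo Hi : ℕ)
    (small : ∀ P → size P ≤ s → FitsIn P (lam * size P))
    (1≤lam : 1 ≤ lam) (0<d : 0 < d) (D≤μs : d + d + (d + d) ≤ μ * s)
    (bounded : DegreesBounded Lo Hi d)
    where

    D κ : ℕ
    D = d + d
    κ = 4 * lam + μ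

    -- Left: the spine ends in the empty forest, and no credit has been earned. Right: it ends in a
    -- branching into two large forests, each of which returns a credit `D`.
    Cheap : ℕ → ℕ → Set
    Cheap v cost = cost ≤ 4 * (lam * v) ⊎ cost + D + D ≤ κ * v

    -- `X` is the width reserved for the core; the factor 4 on `W` is what `embed-spine` charges on
    -- top of `d + d`.
    record Decomposition (P : Forest) : Set where
      constructor decomposition
      field
        Q      : Forest
        W X    : ℕ
        spine  : Spine Q P W
        fits   : ∀ lo hi → Lo ≤ lo → hi ≤ Hi → lo + X ≤ hi → Emb Q lo hi
        cheap  : Cheap (size P) (4 * W + X)

    Cheap-extend : ∀ {w a W X v} → w ≤ lam * a → Cheap v (4 * W + X) →
      Cheap (a + v) (4 * (w + W) + X)
    Cheap-extend {w} {a} {W} {X} {v} w≤ (inj₁ le) = inj₁ (begin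
      4 * (w + W) + X               ≡⟨ lemma₁ w W X ⟩
      4 * w + (4 * W + X)           ≤⟨ +-mono-≤ (*-monoʳ-≤ 4 w≤) le ⟩
      4 * (lam * a) + 4 * (lam * v) ≡⟨ lemma₂ lam a v ⟩
      4 * (lam * (a + v))           ∎)
      where
      open ≤-Reasoning
      lemma₁ : ∀ w W X → 4 * (w + W) + X ≡ 4 * w + (4 * W + X)
      lemma₁ = solve-∀
      lemma₂ : ∀ l a v → 4 * (l * a) + 4 * (l * v) ≡ 4 * (l * (a + v))
      lemma₂ = solve-∀
    Cheap-extend {w} {a} {W} {X} {v} w≤ (inj₂ le) = inj₂ (begin
      4 * (w + W) + X + D + D       ≡⟨ lemma₁ w W X D ⟩
      4 * w + (4 * W + X + D + D)   ≤⟨ +-mono-≤ (*-monoʳ-≤ 4 w≤) le ⟩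
      4 * (lam * a) + κ * v         ≤⟨ m≤n+m _ (μ * a) ⟩
      μ * a + (4 * (lam * a) + κ * v) ≡⟨ lemma₂ lam a v μ ⟩
      κ * (a + v)                   ∎)
      where
      open ≤-Reasoning
      lemma₁ : ∀ w W X D → 4 * (w + W) + X + D + D ≡ 4 * w + (4 * W + X + D + D)
      lemma₁ = solve-∀
      lemma₂ : ∀ l a v μ → μ * a + (4 * (l * a) + (4 * l + μ) * v) ≡ (4 * l + μ) * (a + v)
      lemma₂ = solve-∀

    -- Width `κ * size P` minus the credit `D` suffices; the credit is moved to the other side to
    -- avoid truncated subtraction.
    LargeFits : ℕ → Set
    LargeFits n = ∀ P → size P ≤ n → s < size P → ∀ lo hi → Lo ≤ lo → hi ≤ Hi →
      lo + κ * size P ≤ hi + D → Emb P lo hi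

    D+D≤κ : ∀ {v} → s < v → D + D ≤ κ * v
    D+D≤κ {v} s<v = ≤-trans D≤μs (*-mono-≤ (m≤n+m μ (4 * lam)) (<⇒≤ s<v))

    -- The first tree and the rest are both large, so the spine stops and they are placed side by
    -- side. Their two credits are what the spine ending here will draw on.
    branch : ∀ {n} → LargeFits n → ∀ A B → size (⟨ A ⟩ B) ≤ suc n →
      s < suc (size A) → s < size B → Decomposition (⟨ A ⟩ B)
    branch {n} ih A B le s<A s<B =
      decomposition (⟨ A ⟩ B) 0 (X₁ + X₂) core fits (inj₂ (≤-reflexive cost))
      where
      a = suc (size A)
      X₁ = κ * a ∸ D
      X₂ = κ * size B ∸ D
      X₁+D : X₁ + D ≡ κ * a
      X₁+D = m∸n+n≡m (≤-trans (m≤m+n D D) (D+D≤κ s<A))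
      X₂+D : X₂ + D ≡ κ * size B
      X₂+D = m∸n+n≡m (≤-trans (m≤m+n D D) (D+D≤κ s<B))
      a≡ : suc (size A + 0) ≡ a
      a≡ = cong suc (+-identityʳ (size A))
      within : ∀ {lo X v} → X + D ≡ κ * v → lo + κ * v ≤ lo + X + D
      within {lo} {X} eq = ≤-reflexive (trans (cong (lo +_) (sym eq)) (sym (+-assoc lo X D)))
      fits : ∀ lo hi → Lo ≤ lo → hi ≤ Hi → lo + (X₁ + X₂) ≤ hi → Emb (⟨ A ⟩ B) lo hi
      fits lo hi lo≥ hi≤ le′ =
        append
          -- `B` is nonempty, so the first tree alone is strictly smaller than the whole forest.
          (ih (⟨ A ⟩ ∙)
            (subst (_≤ n) (sym a≡)
              (≤-trans (m≤m+n a _)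
                (≤-pred (subst (_≤ suc n) (lemma A B s<B) le))))
            (subst (s <_) (sym a≡) s<A) lo (lo + X₁) lo≥
            (≤-trans (m≤m+n (lo + X₁) X₂) (≤-trans le″ hi≤))
            (subst (λ t → lo + κ * t ≤ lo + X₁ + D) (sym a≡) (within {lo} {X₁} {a} X₁+D)))
          (ih B (≤-trans (m≤n+m (size B) (size A)) (≤-pred le)) s<B (lo + X₁) hi
            (≤-trans lo≥ (m≤m+n lo X₁)) hi≤
            (≤-trans (within {lo + X₁} {X₂} {size B} X₂+D) (+-monoˡ-≤ D le″)))
        where
        le″ : lo + X₁ + X₂ ≤ hi
        le″ = subst (_≤ hi) (sym (+-assoc lo X₁ X₂)) le′
        lemma : ∀ A B → s < size B → size (⟨ A ⟩ B) ≡ suc (suc (size A) + (size B ∸ 1))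
        lemma A B s<B with size B
        ... | suc b = cong suc (+-suc (size A) b)
      cost : X₁ + X₂ + D + D ≡ κ * size (⟨ A ⟩ B)
      cost = trans (lemma X₁ X₂ D) (trans (cong₂ _+_ X₁+D X₂+D) (sym (*-distribˡ-+ κ a (size B))))
        where
        lemma : ∀ x y D → x + y + D + D ≡ x + D + (y + D)
        lemma = solve-∀

    -- The spine is followed while the first tree or the rest is small: a small first tree hangs on
    -- the left, a small rest on the right, and the walk continues in the other part.
    decompose : ∀ {n} → LargeFits n → ∀ P → size P ≤ suc n → Decomposition P
    decompose ih ∙ le =
      decomposition ∙ 0 0 core (λ lo hi _ _ p → nil (subst (_≤ hi) (+-identityʳ lo) p)) (inj₁ z≤n)
    decompose ih (⟨ A ⟩ B) le with suc (size A) ≤? s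
    ... | yes A≤s with decompose ih B (≤-trans (m≤n+m (size B) (suc (size A))) le)
    ...   | decomposition Q W X spine fits cheap =
      decomposition Q (lam * suc (size A) + W) X (left A-fits spine) fits
        (Cheap-extend {a = suc (size A)} ≤-refl cheap)
      where
      a≡ : suc (size A + 0) ≡ suc (size A)
      a≡ = cong suc (+-identityʳ (size A))
      A-fits : FitsIn (⟨ A ⟩ ∙) (lam * suc (size A))
      A-fits = subst (λ t → FitsIn (⟨ A ⟩ ∙) (lam * t)) a≡
                 (small (⟨ A ⟩ ∙) (subst (_≤ s) (sym a≡) A≤s))
    decompose ih (⟨ A ⟩ B) le | no A≰s with size B ≤? s
    ... | no B≰s = branch ih A B le (≰⇒> A≰s) (≰⇒> B≰s)
    ... | yes B≤s with decompose ih A (≤-trans (≤-trans (m≤m+n (size A) (size B)) (n≤1+n _)) le)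
    ...   | decomposition Q W X spine fits cheap =
      decomposition Q (suc (lam * size B) + W) X (wrap (small B B≤s) spine) fits
        (subst (λ v → Cheap v (4 * (suc (lam * size B) + W) + X))
          (cong suc (+-comm (size B) (size A)))
          (Cheap-extend {a = suc (size B)}
            -- The diagonal entry of the wrapping edge is charged to that edge itself, as `1 ≤ lam`.
            (≤-trans (+-monoˡ-≤ (lam * size B) 1≤lam) (≤-reflexive (sym (*-suc lam (size B)))))
            cheap))

    large-step : ∀ {n} → LargeFits n → LargeFits (suc n)
    large-step ih P P≤ s<P lo hi lo≥ hi≤ le with decompose ih P P≤
    ... | decomposition Q W X spine fits cheap with m≤n⇒∃[o]m+o≡n room
      where
      v = size P
      paid : Cheap v (4 * W + X) → 4 * W + X + D + D ≤ κ * v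
      paid (inj₂ p) = p
      -- Without a branching, `μ` supplies both credits, since the forest has more than `s` edges.
      paid (inj₁ p) = begin
        4 * W + X + D + D       ≡⟨ +-assoc (4 * W + X) D D ⟩
        4 * W + X + (D + D)     ≤⟨ +-mono-≤ p (≤-trans D≤μs (*-monoʳ-≤ μ (<⇒≤ s<P))) ⟩
        4 * (lam * v) + μ * v   ≡⟨ lemma lam v μ ⟩
        κ * v                   ∎
        where
        open ≤-Reasoning
        lemma : ∀ l v μ → 4 * (l * v) + μ * v ≡ (4 * l + μ) * v
        lemma = solve-∀
      room : lo + (4 * W + X + D) ≤ hi
      -- `embed-spine` spends one credit; the other cancels against the one in `LargeFits`.
      room = +-cancelʳ-≤ D _ _
        (≤-trans (≤-reflexive (+-assoc lo (4 * W + X + D) D))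
          (≤-trans (+-monoʳ-≤ lo (paid cheap)) le))
    ... | o , refl =
      subst (Emb P lo) hi-eq
        (embed-spine 0<d spine
          (fits (lo + (W + W)) ch (≤-trans lo≥ (m≤m+n lo (W + W)))
            (≤-trans (m≤m+n ch (W + W + D))
              (≤-trans (≤-reflexive (trans (sym (+-assoc ch (W + W) D)) hi-eq)) hi≤))
            (m≤m+n (lo + (W + W) + X) o))
          (λ x y n x≥ x<y y≤ → bounded x y n (≤-trans lo≥ x≥) x<y
            (≤-trans y≤ (≤-trans (≤-reflexive hi-eq) hi≤))))
      where
      ch = lo + (W + W) + X + o
      hi-eq : ch + (W + W) + D ≡ lo + (4 * W + X + D) + o
      hi-eq = lemma lo W X o D
        where
        lemma : ∀ lo W X o D → lo + (W + W) + X + o + (W + W) + D ≡ lo + (4 * W + X + D) + o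
        lemma = solve-∀

    large : ∀ n → LargeFits n
    large zero    P P≤0 s<P with () ← ≤-trans s<P P≤0
    large (suc n) = large-step (large n)

  -- Iterating the step over powers of `T`

  module Levels (T : ℕ) (1≤T : 1 ≤ T) where

    -- Length per edge at level `j`. One step turns it into `4 * rate j + 8 * T`, and `8 * T` is at
    -- most `rate j`; hence the factor 5.
    rate : ℕ → ℕ
    rate j = 8 * T * 5 ^ j

    8T≤rate : ∀ j → 8 * T ≤ rate j
    8T≤rate j = ≤-trans (≤-reflexive (sym (*-identityʳ (8 * T)))) (*-monoʳ-≤ (8 * T) (m^n>0 5 j))

    8≤rate : ∀ j → 8 ≤ rate j
    8≤rate j = ≤-trans (*-monoʳ-≤ 8 1≤T) (8T≤rate j)

    rate-step : ∀ j → 4 * rate j + 8 * T ≤ rate (suc j)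
    rate-step j = ≤-trans (+-monoʳ-≤ (4 * rate j) (8T≤rate j)) (≤-reflexive (lemma (8 * T) (5 ^ j)))
      where
      lemma : ∀ a b → 4 * (a * b) + a * b ≡ a * (5 * b)
      lemma = solve-∀

    single-edge : ∀ {lo hi} → lo + 3 ≤ hi → Emb (⟨ ∙ ⟩ ∙) lo hi
    single-edge {lo} {hi} le with c lo (1 + lo) in e₁ | c lo (2 + lo) in e₂
    ... | red  | _    = node ≤-refl e₁ (nil ≤-refl) (nil (≤-trans (n≤1+n _) 3+lo≤hi))
      where
      3+lo≤hi : 3 + lo ≤ hi
      3+lo≤hi = subst (_≤ hi) (+-comm lo 3) le
    ... | blue | red  = node ≤-refl e₂ (nil (n≤1+n _)) (nil (subst (_≤ hi) (+-comm lo 3) le))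
    ... | blue | blue = node (n≤1+n lo) (triangle-free lo (1 + lo) (2 + lo) ≤-refl ≤-refl e₁ e₂)
                          (nil ≤-refl) (nil (subst (_≤ hi) (+-comm lo 3) le))

    -- Induction on the level. A forest too large for the previous level either finds a vertex with
    -- enough blue neighbours ahead to hold it, or all forward degrees are small and the recursion
    -- step applies.
    fits-level : ∀ j P → size P ≤ T ^ j → FitsIn P (rate j * size P)
    fits-level zero ∙ _ lo hi le = nil (≤-trans (m≤m+n lo _) le)
    fits-level zero (⟨ ∙ ⟩ ∙) _ lo hi le = single-edge
      (≤-trans (+-monoʳ-≤ lo (≤-trans (m≤m+n 3 5)
        (≤-trans (8≤rate 0) (≤-reflexive (sym (*-identityʳ (rate 0))))))) le)
    fits-level zero (⟨ ∙ ⟩ ⟨ _ ⟩ _) (s≤s ())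
    fits-level zero (⟨ ⟨ _ ⟩ _ ⟩ _) (s≤s ())
    fits-level (suc j) P P≤ lo hi le with size P ≤? T ^ j
    ... | yes P≤s = fits-level j P P≤s lo hi
      (≤-trans (+-monoʳ-≤ lo (*-monoˡ-≤ (size P) rate-mono)) le)
      where
      rate-mono : rate j ≤ rate (suc j)
      rate-mono = *-monoʳ-≤ (8 * T) (m≤m+n (5 ^ j) _)
    ... | no P≰s
      with anyUpTo? (λ x → lo ≤? x ×-dec 2 * T ^ suc j ≤? deg x (suc x) (hi ∸ suc x)) hi
    ... | yes (x , x<hi , lo≤x , big) =
      widen (≤-trans lo≤x (n≤1+n x)) (≤-reflexive (m+[n∸m]≡n x<hi))
        (embed-in-blue-neighbourhood x P (suc x) (hi ∸ suc x) ≤-refl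
          (≤-trans (*-monoʳ-≤ 2 P≤) big))
    ... | no none =
      -- With `s = T ^ j` and `d = 2 * T ^ suc j`, `4 * d` equals `8 * T * s`, so `μ` is `8 * T`.
      Step.large (T ^ j) (rate j) (8 * T) d lo hi (fits-level j)
        (≤-trans (s≤s z≤n) (8≤rate j)) 0<d (≤-reflexive (lemma T (T ^ j))) bounded
        (size P) P ≤-refl (≰⇒> P≰s) lo hi ≤-refl ≤-refl
        (≤-trans (+-monoʳ-≤ lo (*-monoˡ-≤ (size P) (rate-step j))) (≤-trans le (m≤m+n hi _)))
      where
      d = 2 * T ^ suc j
      0<d : 0 < d
      0<d = ≤-trans (*-mono-≤ {1} {2} (s≤s z≤n) (m^n>0 T {{>-nonZero 1≤T}} (suc j))) ≤-refl
      lemma : ∀ T s → 2 * (T * s) + 2 * (T * s) + (2 * (T * s) + 2 * (T * s)) ≡ 8 * T * s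
      lemma = solve-∀
      bounded : DegreesBounded lo hi d
      bounded x y n lo≤x x<y y+n≤hi with d ≤? deg x (suc x) (hi ∸ suc x)
      ... | yes big = ⊥-elim (none (x , x<hi , lo≤x , big))
        where
        x<hi : x < hi
        x<hi = ≤-trans x<y (≤-trans (m≤m+n y n) y+n≤hi)
      ... | no ¬big = ≤-trans
        (deg-mono x x<y (≤-trans y+n≤hi (m≤n+m∸n hi (suc x))))
        (<⇒≤ (≰⇒> ¬big))

-- Splicing of functions

splice : ℕ → (ℕ → ℕ) → (ℕ → ℕ) → ℕ → ℕ
splice m f g i with i <? m
... | yes _ = f i
... | no  _ = g i

splice-left : ∀ m f g {i} → i < m → splice m f g i ≡ f i
splice-left m f g {i} i<m with i <? m
... | yes _   = refl
... | no  i≮m = contradiction i<m i≮m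

splice-right : ∀ m f g {i} → m ≤ i → splice m f g i ≡ g i
splice-right m f g {i} m≤i with i <? m
... | yes i<m = contradiction i<m (≤⇒≯ m≤i)
... | no  _   = refl

-- Parenthesis matchings as forests

module Parenthesis {n} (M : OrderedGraph n)
  (matching : IsMatching M) (noncrossing : IsNonCrossing M) where

  E : ℕ → ℕ → Set
  E i j = ∃₂ λ u v → toℕ u ≡ i × toℕ v ≡ j × Edge M u v

  E-sym : ∀ {i j} → E i j → E j i
  E-sym (u , v , p , q , e) = v , u , q , p , OrderedGraph.sym M e

  E-irrefl : ∀ {i j} → E i j → i ≢ j
  E-irrefl (u , v , refl , refl , e) eq with refl ← Fin.toℕ-injective eq = irrefl M e

  E-functional : ∀ {i j k} → E i j → E i k → j ≡ k
  E-functional (u , v , refl , refl , e) (u′ , v′ , p , refl , e′) with refl ← Fin.toℕ-injective p =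
    cong toℕ (trans (proj₂ (proj₂ (matching u)) v e) (sym (proj₂ (proj₂ (matching u)) v′ e′)))

  E-total : ∀ {i} → i < n → ∃ (E i)
  E-total i<n with matching (fromℕ< i<n)
  ... | v , e , _ = toℕ v , fromℕ< i<n , v , Fin.toℕ-fromℕ< i<n , refl , e

  E-noncrossing : ∀ {i j k l} → i < j → k < l → E i j → E k l →
    ((j < k) ⊎ (l < i)) ⊎ ((k ≤ i × j ≤ l) ⊎ (i ≤ k × l ≤ j))
  E-noncrossing i<j k<l (u , v , refl , refl , e) (u′ , v′ , refl , refl , e′) =
    noncrossing u v u′ v′ i<j k<l e e′

  Closed : ℕ → ℕ → Set
  Closed a b = ∀ {i j} → a ≤ i → i < b → E i j → a ≤ j × j < b

  -- Closedness of the inner interval is stored because it later shows that an edge starting in the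
  -- `A` block also ends there.
  data Represents : ℕ → ℕ → Forest → Set where
    nil  : ∀ {a} → Represents a a ∙
    node : ∀ {a m b A B} → E a m → a < m → Closed (suc a) m →
           Represents (suc a) m A → Represents (suc m) b B → Represents a b (⟨ A ⟩ B)

  Represents-size : ∀ {a b P} → Represents a b P → b ≡ a + 2 * size P
  Represents-size {a} nil = sym (+-identityʳ a)
  Represents-size {a} {P = ⟨ A ⟩ B} (node _ _ _ rA rB)
    with refl ← Represents-size rA | refl ← Represents-size rB = lemma a (size A) (size B)
    where
    lemma : ∀ a x y → suc (suc a + 2 * x) + 2 * y ≡ a + 2 * suc (x + y)
    lemma = solve-∀

  -- The vertices `a` and `m` are taken by each other, and nothing goes below `a`; an edge leaving
  -- past `m` would cross the edge from `a` to `m`.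
  Closed-inside : ∀ {a b m} → Closed a b → E a m → a < m → m < b → Closed (suc a) m
  Closed-inside {a} {b} {m} cl eam a<m m<b {i} {j} a<i i<m eij
    with cl (<⇒≤ a<i) (<-trans i<m m<b) eij
  ... | a≤j , _ = a<j , j<m
    where
    a<j : a < j
    a<j = ≤∧≢⇒< a≤j λ { refl → <-irrefl (E-functional (E-sym eij) eam) i<m }
    j≢m : j ≢ m
    j≢m refl = <-irrefl (E-functional (E-sym eam) (E-sym eij)) a<i
    j<m : j < m
    j<m with <-≤-connex j m
    ... | inj₁ p = p
    ... | inj₂ m≤j with E-noncrossing a<m (<-≤-trans i<m m≤j) eam eij
    ...   | inj₁ (inj₁ m<i)       = contradiction i<m (<-asym m<i)
    ...   | inj₁ (inj₂ j<a)       = contradiction a<j (<-asym j<a)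
    ...   | inj₂ (inj₁ (i≤a , _)) = contradiction a<i (≤⇒≯ i≤a)
    ...   | inj₂ (inj₂ (_ , j≤m)) = ⊥-elim (j≢m (≤-antisym j≤m m≤j))

  -- A partner up to `m` would be an end of the edge from `a` to `m`, or lie under that edge and so
  -- be matched under it.
  Closed-after : ∀ {a b m} → Closed a b → E a m → a < m → m < b → Closed (suc m) b
  Closed-after {a} {b} {m} cl eam a<m m<b {i} {j} m<i i<b eij
    with cl (<⇒≤ (<-trans a<m m<i)) i<b eij
  ... | a≤j , j<b with <-cmp m j
  ...   | tri< m<j _ _  = m<j , j<b
  ...   | tri≈ _ refl _ =
    contradiction (E-functional (E-sym eam) (E-sym eij)) (<⇒≢ (<-trans a<m m<i))
  ...   | tri> _ _ j<m with m≤n⇒m<n∨m≡n a≤j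
  ...     | inj₂ refl = contradiction (E-functional eam (E-sym eij)) (<⇒≢ m<i)
  ...     | inj₁ a<j  =
    contradiction (proj₂ (Closed-inside cl eam a<m m<b a<j j<m (E-sym eij))) (<-asym m<i)

  -- `k` bounds the interval length and makes the recursion structural. The partner of the leftmost
  -- vertex splits the rest into two closed intervals.
  represent : ∀ k a b → b ≤ a + k → a ≤ b → b ≤ n → Closed a b → ∃ (Represents a b)
  represent k a b b≤a+k a≤b b≤n cl with m≤n⇒m<n∨m≡n a≤b
  ... | inj₂ refl = ∙ , nil
  represent zero a b b≤a+k a≤b b≤n cl | inj₁ a<b =
    contradiction (subst (b ≤_) (+-identityʳ a) b≤a+k) (<⇒≱ a<b)
  represent (suc k) a b b≤a+k a≤b b≤n cl | inj₁ a<b with E-total (<-≤-trans a<b b≤n)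
  ... | m , eam with cl ≤-refl a<b eam
  ... | a≤m , m<b = ⟨ proj₁ left ⟩ proj₁ right , node eam a<m inside (proj₂ left) (proj₂ right)
    where
    a<m : a < m
    a<m = ≤∧≢⇒< a≤m (E-irrefl eam)
    b≤1+a+k : b ≤ suc a + k
    b≤1+a+k = subst (b ≤_) (+-suc a k) b≤a+k
    inside : Closed (suc a) m
    inside = Closed-inside cl eam a<m m<b
    left : ∃ (Represents (suc a) m)
    left = represent k (suc a) m (≤-trans (<⇒≤ m<b) b≤1+a+k) a<m (≤-trans (<⇒≤ m<b) b≤n) inside
    right : ∃ (Represents (suc m) b)
    right = represent k (suc m) b (≤-trans b≤1+a+k (+-monoˡ-≤ k (s≤s a≤m))) m<b b≤n
      (Closed-after cl eam a<m m<b)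

  represent-all : ∃ (Represents 0 n)
  represent-all = represent n 0 n ≤-refl z≤n ≤-refl
    λ { _ _ (_ , v , _ , refl , _) → z≤n , Fin.toℕ<n v }

  -- Vertex maps read off from embeddings

  -- A map on an interval, kept as a total function with arbitrary values outside so that pieces can
  -- be spliced.
  record Increasing (a b lo hi : ℕ) : Set where
    field
      at    : ℕ → ℕ
      lower : ∀ {i} → a ≤ i → i < b → lo ≤ at i
      upper : ∀ {i} → a ≤ i → i < b → at i < hi
      mono  : ∀ {i j} → a ≤ i → i < j → j < b → at i < at j
  open Increasing

  empty : ∀ {a lo hi} → Increasing a a lo hi
  empty = record
    { at = λ i → i
    ; lower = λ p q → contradiction q (≤⇒≯ p)
    ; upper = λ p q → contradiction q (≤⇒≯ p)
    ; mono  = λ p q r → contradiction (<-trans q r) (≤⇒≯ p)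
    }

  single : ∀ {a lo hi} x → lo ≤ x → x < hi → Increasing a (suc a) lo hi
  single x lo≤x x<hi = record
    { at = λ _ → x
    ; lower = λ _ _ → lo≤x
    ; upper = λ _ _ → x<hi
    ; mono  = λ { p q (s≤s r) → contradiction (<-≤-trans q r) (≤⇒≯ p) }
    }

  glue : ∀ {a m b lo mid hi} → a ≤ m → m ≤ b → lo ≤ mid → mid ≤ hi →
    Increasing a m lo mid → Increasing m b mid hi → Increasing a b lo hi
  glue {a} {m} {b} {lo} {mid} {hi} a≤m m≤b lo≤mid mid≤hi F G = record
    { at = h ; lower = h-lower ; upper = h-upper ; mono = h-mono }
    where
    h = splice m (at F) (at G)
    h-lower : ∀ {i} → a ≤ i → i < b → lo ≤ h i
    h-lower {i} p q with i <? m
    ... | yes i<m = lower F p i<m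
    ... | no  i≮m = ≤-trans lo≤mid (lower G (≮⇒≥ i≮m) q)
    h-upper : ∀ {i} → a ≤ i → i < b → h i < hi
    h-upper {i} p q with i <? m
    ... | yes i<m = <-≤-trans (upper F p i<m) mid≤hi
    ... | no  i≮m = upper G (≮⇒≥ i≮m) q
    h-mono : ∀ {i j} → a ≤ i → i < j → j < b → h i < h j
    h-mono {i} {j} p q r with i <? m | j <? m
    ... | yes i<m | yes j<m = mono F p q j<m
    ... | yes i<m | no  j≮m = <-≤-trans (upper F p i<m) (lower G (≮⇒≥ j≮m) r)
    ... | no  i≮m | yes j<m = contradiction (<-trans q j<m) i≮m
    ... | no  i≮m | no  j≮m = mono G (≮⇒≥ i≮m) q r

  Represents⇒≤ : ∀ {a b P} → Represents a b P → a ≤ b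
  Represents⇒≤ {a} r = subst (a ≤_) (sym (Represents-size r)) (m≤m+n a _)

  module Copy
    (c : ℕ → ℕ → Colour)
    (triangle-free : ∀ x y z → x < y → y < z → c x y ≡ blue → c x z ≡ blue → c y z ≡ red)
    where

    open Embedding c triangle-free using (Emb; Emb⇒≤; nil; node)

    copy : ∀ {a b P lo hi} → Represents a b P → Emb P lo hi → Increasing a b lo hi
    copy nil _ = empty
    copy (node {a} {m} _ a<m _ rA rB) (node {x = x} {y} lo≤x _ eA eB) =
      glue (n≤1+n a) (≤-trans a<m (≤-trans (n≤1+n m) (Represents⇒≤ rB)))
           (≤-trans lo≤x (n≤1+n x)) (≤-trans (Emb⇒≤ eA) (≤-trans (n≤1+n y) (Emb⇒≤ eB)))
        (single x lo≤x ≤-refl)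
        (glue a<m (≤-trans (n≤1+n m) (Represents⇒≤ rB)) (Emb⇒≤ eA) (≤-trans (n≤1+n y) (Emb⇒≤ eB))
          (copy rA eA)
          (glue (n≤1+n m) (Represents⇒≤ rB) (n≤1+n y) (Emb⇒≤ eB)
            (single y ≤-refl ≤-refl)
            (copy rB eB)))

    module _ {a m b A B lo hi x y} (eam : E a m) (a<m : a < m) (cl : Closed (suc a) m)
      (rA : Represents (suc a) m A) (rB : Represents (suc m) b B)
      (lo≤x : lo ≤ x) (r : c x y ≡ red) (eA : Emb A (suc x) y) (eB : Emb B (suc y) hi) where

      private
        whole : Increasing a b lo hi
        whole = copy (node eam a<m cl rA rB) (node lo≤x r eA eB)

        -- These name the layers of `splice` that `glue` builds inside `copy`.
        f g h₁ h₂ : ℕ → ℕ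
        f  = at (copy rA eA)
        g  = at (copy rB eB)
        h₁ = splice (suc m) (λ _ → y) g
        h₂ = splice m f h₁

      copy-open : at whole a ≡ x
      copy-open = splice-left (suc a) (λ _ → x) h₂ ≤-refl

      copy-inside : ∀ {i} → a < i → i < m → at whole i ≡ at (copy rA eA) i
      copy-inside a<i i<m = trans (splice-right (suc a) (λ _ → x) h₂ a<i) (splice-left m f h₁ i<m)

      copy-close : at whole m ≡ y
      copy-close = trans (splice-right (suc a) (λ _ → x) h₂ a<m)
        (trans (splice-right m f h₁ ≤-refl) (splice-left (suc m) (λ _ → y) g ≤-refl))

      copy-after : ∀ {i} → m < i → at whole i ≡ at (copy rB eB) i
      copy-after m<i = trans (splice-right (suc a) (λ _ → x) h₂ (<-trans a<m m<i))
        (trans (splice-right m f h₁ (<⇒≤ m<i)) (splice-right (suc m) (λ _ → y) g m<i))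

    -- Split on `i`: at `a` the edge is the red pair of the node, at `m` it would run backwards, and
    -- elsewhere both ends lie in the same block.
    copy-red : ∀ {a b P lo hi} (r : Represents a b P) (e : Emb P lo hi) →
      ∀ {i j} → a ≤ i → i < j → j < b → E i j → c (at (copy r e) i) (at (copy r e) j) ≡ red
    copy-red nil _ a≤i i<j j<a _ = contradiction (<-trans i<j j<a) (≤⇒≯ a≤i)
    copy-red (node {a} {m} eam a<m cl rA rB) (node lo≤x r eA eB) {i} {j} a≤i i<j j<b eij
      with m≤n⇒m<n∨m≡n a≤i
    ... | inj₂ refl with refl ← E-functional eam eij =
      trans (cong₂ c (copy-open eam a<m cl rA rB lo≤x r eA eB)
                     (copy-close eam a<m cl rA rB lo≤x r eA eB)) r
    ... | inj₁ a<i with <-cmp i m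
    ...   | tri< i<m _ _ with cl a<i i<m eij
    ...     | a<j , j<m =
      trans (cong₂ c (copy-inside eam a<m cl rA rB lo≤x r eA eB a<i i<m)
                     (copy-inside eam a<m cl rA rB lo≤x r eA eB a<j j<m))
            (copy-red rA eA a<i i<j j<m eij)
    copy-red (node {a} {m} eam a<m cl rA rB) (node lo≤x r eA eB) {i} {j} a≤i i<j j<b eij
      | inj₁ a<i | tri≈ _ refl _ =
      contradiction (E-functional (E-sym eam) eij) (<⇒≢ (<-trans a<i i<j))
    copy-red (node {a} {m} eam a<m cl rA rB) (node lo≤x r eA eB) {i} {j} a≤i i<j j<b eij
      | inj₁ a<i | tri> _ _ m<i =
      trans (cong₂ c (copy-after eam a<m cl rA rB lo≤x r eA eB m<i)
                     (copy-after eam a<m cl rA rB lo≤x r eA eB (<-trans m<i i<j)))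
            (copy-red rB eB m<i i<j j<b eij)

  -- From finite colourings to colourings of all pairs

  module _ {N} (col : Colouring N) where

    -- Pairs out of range are red, so every blue pair comes from `col` and no new blue triangle
    -- arises.
    extend : ℕ → ℕ → Colour
    extend x y with x <? N | y <? N
    ... | yes x<N | yes y<N = col (fromℕ< x<N) (fromℕ< y<N)
    ... | _       | _       = red

    extend-fromℕ< : ∀ {x y} (x<N : x < N) (y<N : y < N) →
      extend x y ≡ col (fromℕ< x<N) (fromℕ< y<N)
    extend-fromℕ< {x} {y} x<N y<N with x <? N | y <? N
    ... | yes _   | yes _   = refl
    ... | yes _   | no y≮N  = contradiction y<N y≮N
    ... | no x≮N  | _       = contradiction x<N x≮N

    extend-blue : ∀ x y → extend x y ≡ blue →
      ∃₂ λ u v → toℕ u ≡ x × toℕ v ≡ y × col u v ≡ blue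
    extend-blue x y eq with x <? N | y <? N
    extend-blue x y eq | yes x<N | yes y<N =
      fromℕ< x<N , fromℕ< y<N , Fin.toℕ-fromℕ< x<N , Fin.toℕ-fromℕ< y<N , eq
    extend-blue x y () | yes _ | no _
    extend-blue x y () | no _  | _

    blue? : ∀ k → Dec (k ≡ blue)
    blue? red  = no λ ()
    blue? blue = yes refl

    BlueTriangle : Fin N → Fin N → Fin N → Set
    BlueTriangle u v w = u Fin.< v × v Fin.< w × col u v ≡ blue × col u w ≡ blue × col v w ≡ blue

    blue-triangle⇒copy : ∀ {u v w} → BlueTriangle u v w → HasCopy col blue K₃
    blue-triangle⇒copy {u} {v} {w} (u<v , v<w , uv , uw , vw) = φ , φ-mono , φ-blue
      where
      φ : Fin 3 → Fin N
      φ Fin.zero                    = u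
      φ (Fin.suc Fin.zero)           = v
      φ (Fin.suc (Fin.suc Fin.zero)) = w
      φ-mono : ∀ i j → i Fin.< j → φ i Fin.< φ j
      φ-mono Fin.zero (Fin.suc Fin.zero) _ = u<v
      φ-mono Fin.zero (Fin.suc (Fin.suc Fin.zero)) _ = <-trans u<v v<w
      φ-mono (Fin.suc Fin.zero) (Fin.suc (Fin.suc Fin.zero)) _ = v<w
      φ-mono (Fin.suc Fin.zero) (Fin.suc Fin.zero) (s≤s ())
      φ-mono (Fin.suc (Fin.suc Fin.zero)) (Fin.suc Fin.zero) (s≤s ())
      φ-mono (Fin.suc (Fin.suc Fin.zero)) (Fin.suc (Fin.suc Fin.zero)) (s≤s (s≤s ()))
      φ-blue : ∀ i j → i Fin.< j → i ≢ j → col (φ i) (φ j) ≡ blue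
      φ-blue Fin.zero (Fin.suc Fin.zero) _ _ = uv
      φ-blue Fin.zero (Fin.suc (Fin.suc Fin.zero)) _ _ = uw
      φ-blue (Fin.suc Fin.zero) (Fin.suc (Fin.suc Fin.zero)) _ _ = vw
      φ-blue (Fin.suc Fin.zero) (Fin.suc Fin.zero) (s≤s ()) _
      φ-blue (Fin.suc (Fin.suc Fin.zero)) (Fin.suc Fin.zero) (s≤s ()) _
      φ-blue (Fin.suc (Fin.suc Fin.zero)) (Fin.suc (Fin.suc Fin.zero)) (s≤s (s≤s ())) _

    extend-triangle-free : ¬ (∃ λ u → ∃ λ v → ∃ λ w → BlueTriangle u v w) →
      ∀ x y z → x < y → y < z → extend x y ≡ blue → extend x z ≡ blue → extend y z ≡ red
    extend-triangle-free none x y z x<y y<z xy xz with extend y z in yz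
    ... | red  = refl
    ... | blue with extend-blue x y xy | extend-blue x z xz | extend-blue y z yz
    ...   | u , v , refl , refl , uv | u′ , w , p , refl , uw | v′ , w′ , q , r , vw
      with refl ← Fin.toℕ-injective p | refl ← Fin.toℕ-injective q | refl ← Fin.toℕ-injective r =
      ⊥-elim (none (u , v , w , x<y , y<z , uv , uw , vw))

  arrows : ∀ {P} T j → 1 ≤ T → Represents 0 n P → size P ≤ T ^ j →
    Arrows (8 * T * 5 ^ j * size P) M K₃
  arrows {P} T j 1≤T r P≤ col
    with Fin.any? (λ u → Fin.any? (λ v → Fin.any? (λ w →
           u Fin.<? v ×-dec v Fin.<? w ×-dec blue? col (col u v) ×-dec blue? col (col u w)
             ×-dec blue? col (col v w))))
  ... | yes (_ , _ , _ , t) = inj₂ (blue-triangle⇒copy col t)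
  ... | no none = inj₁ (φ , φ-mono , φ-red)
    where
    N = 8 * T * 5 ^ j * size P
    c = extend col
    open Copy c (extend-triangle-free col none)
    emb = Embedding.Levels.fits-level c (extend-triangle-free col none) T 1≤T j P P≤ 0 N ≤-refl
    F = copy r emb
    at<N : ∀ u → at F (toℕ u) < N
    at<N u = upper F z≤n (Fin.toℕ<n u)
    φ : Fin n → Fin N
    φ u = fromℕ< (at<N u)
    φ-mono : ∀ u v → u Fin.< v → φ u Fin.< φ v
    φ-mono u v u<v = subst₂ _<_ (sym (Fin.toℕ-fromℕ< (at<N u))) (sym (Fin.toℕ-fromℕ< (at<N v)))
      (mono F z≤n u<v (Fin.toℕ<n v))
    φ-red : ∀ u v → u Fin.< v → Edge M u v → col (φ u) (φ v) ≡ red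
    φ-red u v u<v e = trans (sym (extend-fromℕ< col (at<N u) (at<N v)))
      (copy-red r emb z≤n u<v (Fin.toℕ<n v) (u , v , refl , refl , e))

-- Choice of the level and final estimate

-- The exponent rises only when `T ^ j` is too small for the new value, which keeps the overshoot
-- within a factor `T`.
power-above : ∀ T → 2 ≤ T → ∀ v → ∃ λ j → suc v ≤ T ^ j × T ^ j ≤ T * suc v
power-above T 2≤T zero =
  0 , ≤-refl , ≤-trans (≤-trans (n≤1+n 1) 2≤T) (≤-reflexive (sym (*-identityʳ T)))
power-above T 2≤T (suc v) with power-above T 2≤T v
... | j , le , ge with suc (suc v) ≤? T ^ j
...   | yes le′ = j , le′ , ≤-trans ge (*-monoʳ-≤ T (n≤1+n (suc v)))
...   | no  nle = suc j ,
  ≤-trans (≤-trans (s≤s (m≤n+m (suc v) v)) (≤-reflexive (lemma v))) (*-mono-≤ 2≤T le) ,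
  *-monoʳ-≤ T (<⇒≤ (≰⇒> nle))
  where
  lemma : ∀ v → suc (v + suc v) ≡ 2 * suc v
  lemma = solve-∀

^-distribʳ-* : ∀ a b q → (a * b) ^ q ≡ a ^ q * b ^ q
^-distribʳ-* a b zero    = refl
^-distribʳ-* a b (suc q) = trans (cong (a * b *_) (^-distribʳ-* a b q)) (lemma a b (a ^ q) (b ^ q))
  where
  lemma : ∀ a b x y → a * b * (x * y) ≡ a * x * (b * y)
  lemma = solve-∀

-- With T = 5^q the factor 5 lost per level is T^(1/q), so ε = 1/q already suffices.
size-bound : ∀ p q j v n → let T = 5 ^ q in 0 < p → 0 < q → 0 < v → v ≤ n →
  T ^ j ≤ T * v → (8 * T * 5 ^ j * v) ^ q ≤ (8 * T * T) ^ q * n ^ (q + p)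
size-bound p q@(suc q-1) j v n 0<p 0<q 0<v v≤n le = begin
  (8 * T * 5 ^ j * v) ^ q           ≡⟨ ^-distribʳ-* (8 * T * 5 ^ j) v q ⟩
  (8 * T * 5 ^ j) ^ q * v ^ q       ≡⟨ cong (_* v ^ q) (^-distribʳ-* (8 * T) (5 ^ j) q) ⟩
  (8 * T) ^ q * (5 ^ j) ^ q * v ^ q ≡⟨ cong (λ t → (8 * T) ^ q * t * v ^ q) swap ⟩
  (8 * T) ^ q * T ^ j * v ^ q       ≤⟨ *-monoˡ-≤ (v ^ q) (*-monoʳ-≤ ((8 * T) ^ q) le) ⟩
  (8 * T) ^ q * (T * v) * v ^ q     ≤⟨ *-monoˡ-≤ (v ^ q) (*-monoʳ-≤ ((8 * T) ^ q) (*-monoˡ-≤ v T≤T^q)) ⟩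
  (8 * T) ^ q * (T ^ q * v) * v ^ q ≡⟨ lemma ((8 * T) ^ q) (T ^ q) v (v ^ q) ⟩
  (8 * T) ^ q * T ^ q * v ^ suc q   ≡⟨ cong (_* v ^ suc q) (^-distribʳ-* (8 * T) T q) ⟨
  (8 * T * T) ^ q * v ^ suc q       ≤⟨ *-monoʳ-≤ ((8 * T * T) ^ q) (^-monoˡ-≤ (suc q) v≤n) ⟩
  (8 * T * T) ^ q * n ^ suc q       ≤⟨ *-monoʳ-≤ ((8 * T * T) ^ q) n^1+q≤ ⟩
  (8 * T * T) ^ q * n ^ (q + p)     ∎
  where
  open ≤-Reasoning
  T = 5 ^ q
  swap : (5 ^ j) ^ q ≡ T ^ j
  swap = trans (^-*-assoc 5 j q) (trans (cong (5 ^_) (*-comm j q)) (sym (^-*-assoc 5 q j)))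
  T≤T^q : T ≤ T ^ q
  T≤T^q = ≤-trans (≤-reflexive (sym (*-identityʳ T)))
    (^-monoʳ-≤ T {{>-nonZero (m^n>0 5 q)}} {1} {q} 0<q)
  1+q≤ : suc q ≤ q + p
  1+q≤ = ≤-trans (≤-reflexive (+-comm 1 q)) (+-monoʳ-≤ q 0<p)
  n^1+q≤ : n ^ suc q ≤ n ^ (q + p)
  n^1+q≤ = ^-monoʳ-≤ n {{>-nonZero (≤-trans 0<v v≤n)}} 1+q≤
  lemma : ∀ a b v w → a * (b * v) * w ≡ a * b * (v * w)
  lemma = solve-∀

-- The exponent ε is the rational `p / q`, and `q`-th powers keep the inequality within the natural
-- numbers. Any `N` with `Arrows N M K₃` bounds the Ramsey number from above.
theorem9 : (p q : ℕ) → 0 < p → 0 < q →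
    Σ ℕ λ c → (n : ℕ) (M : OrderedGraph n) → IsParenthesisMatching M →
    Σ ℕ λ N → Arrows N M K₃ × (N ^ q ≤ c ^ q * n ^ (q + p))
theorem9 p q@(suc q-1) 0<p 0<q = 8 * T * T , λ n M (matching , noncrossing) →
  bound n M matching noncrossing (Parenthesis.represent-all M matching noncrossing)
  where
  T = 5 ^ q
  1≤T : 1 ≤ T
  1≤T = m^n>0 5 q
  2≤T : 2 ≤ T
  2≤T = ≤-trans (m≤m+n 2 3) (≤-trans (≤-reflexive (sym (*-identityʳ 5))) (*-monoʳ-≤ 5 (m^n>0 5 q-1)))
  bound : ∀ n M matching noncrossing → ∃ (Parenthesis.Represents M matching noncrossing 0 n) →
    Σ ℕ λ N → Arrows N M K₃ × (N ^ q ≤ (8 * T * T) ^ q * n ^ (q + p))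
  bound n M matching noncrossing (∙ , r) =
    -- `power-above` handles positive sizes only; the empty forest gets length 0, written in the
    -- form that `arrows` has at level 0.
    8 * T * 1 * 0 , Parenthesis.arrows M matching noncrossing T 0 1≤T r z≤n ,
    subst (λ t → t ^ q ≤ (8 * T * T) ^ q * n ^ (q + p)) (sym (*-zeroʳ (8 * T * 1))) z≤n
  bound n M matching noncrossing (P@(⟨ A ⟩ B) , r) with power-above T 2≤T (size A + size B)
  ... | j , P≤ , ge =
    8 * T * 5 ^ j * size P , Parenthesis.arrows M matching noncrossing T j 1≤T r P≤ ,
    size-bound p q j (size P) n 0<p 0<q (s≤s z≤n)
      (subst (size P ≤_) (sym (Parenthesis.Represents-size M matching noncrossing r))
        (m≤m+n (size P) _)) ge
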